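{- Let $q,d\geq 2$ be integers and let $\psi\in\mathbb{Z}$, $\psi\neq 0$. Then for every $\theta,x\in\mathbb{Z}$, the natural density of the set $\{n\in\mathbb{N}: \psi w_q(n)+\theta n+x\equiv 0\pmod d\}$ exists and equals $$\begin{cases}\frac{1}{d}\gcd(\psi,\theta,d) & \text{if } \gcd(\psi,\theta,d)\mid\gcd(x,d),\\ 0 & \text{otherwise.}\end{cases}$$
   Context: For an integer $q\geq 2$ and $n\in\mathbb{N}$: $v_q(0)=0$ and, for $n>0$, $v_q(n)=\max\{k: q^k\mid n\}$; $w_q(n)=\sum_{i=0}^n v_q(i)$. The natural density of $T\subseteq\mathbb{N}$ is $\lim_{N\to\infty}|\{n\in T: 0\leq n<N\}|/N$. -}

module Defs where

open import Data.Bool.Base using (if_then_else_)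
open import Data.Integer.Base as ℤ using (ℤ; +_)
open import Data.Integer.Divisibility using (_∣_)
open import Data.Integer.GCD using (gcd)
open import Data.List.Base using (filter; length; map; upTo)
open import Data.List.Extrema.Nat using (max; argmax-all; xs≤max)
open import Data.List.Membership.Propositional.Properties using (∈-filter⁺; ∈-upTo⁺)
import Data.List.Relation.Unary.All as All
open import Data.List.Relation.Unary.All.Properties using (all-filter)
open import Data.Nat.Base using (ℕ; zero; suc; _+_; _^_; _≤_; _<_; NonZero; s≤s; z≤n)
import Data.Nat.Divisibility as ℕ
open import Data.Nat.ListAction using (sum)
open import Data.Nat.Properties
  using (<-≤-trans; m≤n⇒m≤1+n; ≤-trans; ≤-reflexive; +-identityʳ; +-mono-≤; *-monoˡ-≤)
open import Data.Product.Base using (∃-syntax)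
open import Data.Rational.Base as ℚ using (ℚ; 0ℚ; _/_)
open import Function.Base using (id)
open import Relation.Binary.PropositionalEquality.Core using (cong; sym)
open import Relation.Nullary.Decidable.Core using (Dec; does)
open import Relation.Unary using (Pred; Decidable)

-- The maximum of {k : qᵏ ∣ n} is searched among k ≤ n, which loses nothing
-- for q ≥ 2 and n > 0 since then qᵏ > k; see v-divides and v-greatest.
-- For q ≤ 1 the value is meaningless.
v : ℕ → ℕ → ℕ
v q zero      = 0
v q n@(suc _) = max 0 (filter (λ k → q ^ k ℕ.∣? n) (upTo (suc n)))

v-divides : ∀ q n → q ^ v q n ℕ.∣ n
v-divides q zero      = (q ^ 0) ℕ.∣0
v-divides q n@(suc _) =
  argmax-all id {P = λ k → q ^ k ℕ.∣ n} (ℕ.1∣ n)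
    (all-filter (λ k → q ^ k ℕ.∣? n) (upTo (suc n)))

k<q^k : ∀ {q} → 2 ≤ q → ∀ k → k < q ^ k
k<q^k     2≤q zero    = s≤s z≤n
k<q^k {q} 2≤q (suc k) = ≤-trans
  (+-mono-≤ (≤-trans (s≤s z≤n) (k<q^k 2≤q k)) (k<q^k 2≤q k))
  (≤-trans (≤-reflexive (cong (λ m → q ^ k + m) (sym (+-identityʳ (q ^ k)))))
           (*-monoˡ-≤ (q ^ k) 2≤q))

v-greatest : ∀ {q} → 2 ≤ q → ∀ {n} → 0 < n → ∀ {k} → q ^ k ℕ.∣ n → k ≤ v q n
v-greatest {q} 2≤q {n@(suc _)} _ {k} qᵏ∣n = All.lookup (xs≤max 0 _)
  (∈-filter⁺ (λ j → q ^ j ℕ.∣? n)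
    (∈-upTo⁺ (<-≤-trans (k<q^k 2≤q k) (m≤n⇒m≤1+n (ℕ.∣⇒≤ qᵏ∣n))))
    qᵏ∣n)

w : ℕ → ℕ → ℕ
w q n = sum (map (v q) (upTo (suc n)))

infix 4 _≡_[mod_] _≡?_[mod_]

_≡_[mod_] : ℤ → ℤ → ℕ → Set
a ≡ b [mod d ] = + d ∣ a ℤ.- b

_≡?_[mod_] : ∀ a b d → Dec (a ≡ b [mod d ])
a ≡? b [mod d ] = d ℕ.∣? ℤ.∣ a ℤ.- b ∣

count : ∀ {ℓ} {T : Pred ℕ ℓ} → Decidable T → ℕ → ℕ
count T? N = length (filter T? (upTo N))

-- The limit of count T? N / N exists and is L.  Testing against rational ε
-- is the same as testing against real ε.
HasNaturalDensity : ∀ {ℓ} {T : Pred ℕ ℓ} → Decidable T → ℚ → Set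
HasNaturalDensity T? L =
  ∀ ε → 0ℚ ℚ.< ε →
  ∃[ N₀ ] (∀ N .{{_ : NonZero N}} → N₀ ≤ N →
    ℚ.∣ (+ count T? N) / N ℚ.- L ∣ ℚ.< ε)

gcd₃ : ℤ → ℤ → ℤ → ℤ
gcd₃ a b c = gcd (gcd a b) c

infix 4 _∣?_

_∣?_ : ∀ a b → Dec (a ∣ b)
a ∣? b = ℤ.∣ a ∣ ℕ.∣? ℤ.∣ b ∣

densityValue : (ψ θ x : ℤ) (d : ℕ) .{{_ : NonZero d}} → ℚ
densityValue ψ θ x d =
  if does (gcd₃ ψ θ (+ d) ∣? gcd x (+ d))
  then gcd₃ ψ θ (+ d) / d
  else 0ℚ

{-# OPTIONS --safe #-}
-- For L-digit numbers s, w (q^L m + s) = w m + R m + w s with R = 1 + q + … + q^(L-1),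
-- so replacing the lowest L-digit block s by t ≡ s (mod d) changes w mod d exactly by
-- w t - w s and leaves all residues n mod d alone.  Since the residues mod d of the
-- repunits R repeat, there are s and t for which this change is any prescribed δ.
-- Put X x = #{n < N : d ∣ ψ w n + θ n + x}.  Splitting n by its lowest block writes
-- X x and X (x + ψ δ) as sums of Q = q^L counts of the same kind, with one common
-- summand; hence |X x - X (x + ψ δ)| contracts by (Q - 1)/Q at each block and is o(N).
-- Averaging over all shifts by ψ removes w, which makes X invariant under x ↦ x + θ up
-- to o(N) as well, hence by Bézout under x ↦ x + g with g = gcd(ψ, θ, d).  If g ∣ x,
-- then X x, X (x + g), …, X (x + d - g) add up to N; if g ∤ x, then X x = 0.
module Submission where

open import Data.Bool.Base using (true; false; if_then_else_)
open import Data.Fin.Base using (Fin; toℕ; fromℕ<; punchIn)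
open import Data.Fin.Permutation using (transpose; _⟨$⟩ʳ_)
open import Data.Fin.Properties using (_≟_; toℕ<n; toℕ-fromℕ<; fromℕ<-injective; pigeonhole)
open import Data.List.Base using (applyUpTo; filter; length; map; upTo; [_]; _++_)
open import Data.List.Properties using (map-++; upTo-∷ʳ)
import Data.Nat.Base as ℕ
open import Data.Nat.Base using (ℕ; zero; suc; _≤_; _<_; z≤n; s≤s; NonZero; >-nonZero)
import Data.Nat.Divisibility as ℕ
open import Data.Nat.DivMod using (m≡m%n+[m/n]*n; m%n<n; m%n%n≡m%n; m<n*o⇒m/o<n)
import Data.Nat.GCD as ℕ
import Data.Nat.ListAction as List
open import Data.Nat.ListAction.Properties using (sum-++)
import Data.Nat.Properties as ℕ
open import Data.Nat.Properties using (<⇒≤)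
open import Data.Product.Base using (∃; ∃-syntax; ∃₂; _×_; _,_; proj₁; proj₂)
open import Data.Sum.Base using (inj₁; inj₂)
open import Data.Vec.Functional using (Vector; removeAt)
open import Function.Base using (_∘_; id; it)
open import Relation.Binary.PropositionalEquality
  using (_≡_; _≢_; refl; sym; trans; cong; cong₂; subst; subst₂; module ≡-Reasoning)
open import Relation.Nullary.Decidable using (Dec; does; yes; no; dec-true; dec-false)
open import Relation.Nullary.Negation.Core using (¬_; contradiction)
open import Relation.Unary using (Pred; Decidable)
open import Algebra.Properties.Semiring.Sum ℕ.+-*-semiring
  using (sum; sum-cong-≗; sum-remove; ∑-distrib-+; ∑-comm; sum-permute)
open import Defs

module _ where
  open import Data.Nat.Base using (_+_; _*_; _^_)
  open import Data.Nat.Tactic.RingSolver using (solve-∀)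
  open ℕ.≤-Reasoning

  -- Finite sums of natural numbers.

  sum< : ℕ → (ℕ → ℕ) → ℕ
  sum< N f = sum {N} (f ∘ toℕ)

  sum-mono-≤ : ∀ {n} {f g : Vector ℕ n} → (∀ i → f i ≤ g i) → sum f ≤ sum g
  sum-mono-≤ {zero}  f≤g = z≤n
  sum-mono-≤ {suc n} f≤g = ℕ.+-mono-≤ (f≤g _) (sum-mono-≤ (f≤g ∘ Fin.suc))

  sum-const : ∀ n c → sum {n} (λ _ → c) ≡ n * c
  sum-const zero    c = refl
  sum-const (suc n) c = cong (c +_) (sum-const n c)

  sum<-cong : ∀ N {f g : ℕ → ℕ} → (∀ n → f n ≡ g n) → sum< N f ≡ sum< N g
  sum<-cong N f≡g = sum-cong-≗ {N} (f≡g ∘ toℕ)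

  sum<-comm : ∀ M N (f : ℕ → ℕ → ℕ) → sum< M (λ m → sum< N (f m)) ≡ sum< N (λ n → sum< M (λ m → f m n))
  sum<-comm M N f = ∑-comm {M} {N} (λ m n → f (toℕ m) (toℕ n))

  sum<-suc : ∀ N f → sum< (suc N) f ≡ sum< N f + f N
  sum<-suc zero    f = ℕ.+-identityʳ (f 0)
  sum<-suc (suc N) f = trans (cong (f 0 +_) (sum<-suc N (f ∘ suc)))
                             (sym (ℕ.+-assoc (f 0) _ _))

  sum<-+ : ∀ m n f → sum< (m + n) f ≡ sum< m f + sum< n (λ i → f (m + i))
  sum<-+ zero    n f = refl
  sum<-+ (suc m) n f = trans (cong (f 0 +_) (sum<-+ m n (f ∘ suc)))
                             (sym (ℕ.+-assoc (f 0) _ _))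

  sum<-* : ∀ M Q f → sum< (M * Q) f ≡ sum< M (λ m → sum< Q (λ s → f (m * Q + s)))
  sum<-* zero    Q f = refl
  sum<-* (suc M) Q f = trans (sum<-+ Q (M * Q) f) (cong (sum< Q f +_)
    (trans (sum<-* M Q (λ i → f (Q + i)))
           (sum-cong-≗ {M} λ m → sum-cong-≗ {Q} λ s → cong f (sym (ℕ.+-assoc Q (toℕ m * Q) (toℕ s))))))

  sum<-cyclic : ∀ N f → f N ≡ f 0 → sum< N (f ∘ suc) ≡ sum< N f
  sum<-cyclic N f fN≡f0 = ℕ.+-cancelˡ-≡ (f 0) _ _
    (trans (sum<-suc N f) (trans (cong (sum< N f +_) fN≡f0) (ℕ.+-comm (sum< N f) (f 0))))

  -- Pair a t with b s, a s with b t, and a r with b r otherwise.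
  sum-exchange : ∀ {n} (a b : Vector ℕ (suc n)) (s t : Fin (suc n)) B →
    (∀ r → a r ≤ b r + B) → a t ≤ b s → a s ≤ b t + B →
    sum a ≤ sum b + n * B
  sum-exchange {n} a b s t B a≤b at≤bs as≤bt = begin
    sum a                                        ≡⟨ sum-remove {i = t} a ⟩
    a t + sum (removeAt a t)                     ≤⟨ ℕ.+-mono-≤ at≤b′t (sum-mono-≤ (a≤b′ ∘ punchIn t)) ⟩
    b′ t + sum (λ i → removeAt b′ t i + B)        ≡⟨ cong (b′ t +_) (∑-distrib-+ (removeAt b′ t) (λ _ → B)) ⟩
    b′ t + (sum (removeAt b′ t) + sum {n} (λ _ → B)) ≡⟨ ℕ.+-assoc (b′ t) _ _ ⟨
    b′ t + sum (removeAt b′ t) + sum {n} (λ _ → B)   ≡⟨ cong₂ _+_ (sum-remove {i = t} b′) (sym (sum-const n B)) ⟨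
    sum b′ + n * B                                ≡⟨ cong (_+ n * B) (sum-permute b (transpose s t)) ⟨
    sum b + n * B                                ∎
    where
    b′ : Vector ℕ (suc n)
    b′ i = b (transpose s t ⟨$⟩ʳ i)
    at≤b′t : a t ≤ b′ t
    at≤b′t with t ≟ s
    ... | yes refl = at≤bs
    -- `transpose` compares with `s` first and with `t` second, so its value at `t` only computes
    -- after both tests.
    ... | no _ with t ≟ t
    ...   | yes _  = at≤bs
    ...   | no t≢t = contradiction refl t≢t
    a≤b′ : ∀ r → a r ≤ b′ r + B
    a≤b′ r with r ≟ s
    ... | yes refl = as≤bt
    ... | no _ with r ≟ t
    ...   | yes refl = ℕ.m≤n⇒m≤n+o B at≤bs
    ...   | no _     = a≤b r

  -- Inequalities up to o(N).

  infix 4 _≲_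

  -- f ≤ g + o(N)
  _≲_ : (ℕ → ℕ) → (ℕ → ℕ) → Set
  f ≲ g = ∀ k → ∃[ N₀ ] (∀ N → N₀ ≤ N → k * f N ≤ k * g N + N)

  ≲-bounded : ∀ {f g} C → (∀ N → f N ≤ g N + C) → f ≲ g
  ≲-bounded {f} {g} C f≤g+C k = k * C , λ N kC≤N → begin
    k * f N         ≤⟨ ℕ.*-monoʳ-≤ k (f≤g+C N) ⟩
    k * (g N + C)   ≡⟨ ℕ.*-distribˡ-+ k (g N) C ⟩
    k * g N + k * C ≤⟨ ℕ.+-monoʳ-≤ (k * g N) kC≤N ⟩
    k * g N + N     ∎

  ≤⇒≲ : ∀ {f g} → (∀ N → f N ≤ g N) → f ≲ g
  ≤⇒≲ f≤g = ≲-bounded 0 λ N → ℕ.m≤n⇒m≤n+o 0 (f≤g N)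

  ≲-reflexive : ∀ {f g} → (∀ N → f N ≡ g N) → f ≲ g
  ≲-reflexive f≡g = ≤⇒≲ (ℕ.≤-reflexive ∘ f≡g)

  ≲-+ : ∀ {f g f′ g′} → f ≲ g → f′ ≲ g′ → (λ N → f N + f′ N) ≲ (λ N → g N + g′ N)
  ≲-+ {f} {g} {f′} {g′} f≲g f′≲g′ k =
    -- Both hypotheses are used with the factor `2 * k`: the two errors `N` add up to `2 * N`, and
    -- the final cancellation of 2 leaves one.
    let N₁ , h₁ = f≲g (2 * k)
        N₂ , h₂ = f′≲g′ (2 * k)
    in N₁ ℕ.⊔ N₂ , λ N N₁⊔N₂≤N → ℕ.*-cancelˡ-≤ 2 (begin
    2 * (k * (f N + f′ N))                      ≡⟨ expand k (f N) (f′ N) ⟩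
    2 * k * f N + 2 * k * f′ N                  ≤⟨ ℕ.+-mono-≤ (h₁ N (ℕ.m⊔n≤o⇒m≤o N₁ N₂ N₁⊔N₂≤N))
                                                             (h₂ N (ℕ.m⊔n≤o⇒n≤o N₁ N₂ N₁⊔N₂≤N)) ⟩
    (2 * k * g N + N) + (2 * k * g′ N + N)      ≡⟨ collect k (g N) (g′ N) N ⟩
    2 * (k * (g N + g′ N) + N)                  ∎)
    where
    expand : ∀ k a b → 2 * (k * (a + b)) ≡ 2 * k * a + 2 * k * b
    expand = solve-∀
    collect : ∀ k a b n → (2 * k * a + n) + (2 * k * b + n) ≡ 2 * (k * (a + b) + n)
    collect = solve-∀

  -- Adding the two relations with `≲-+` keeps the error at a single `N`; then `k * g N` cancels.
  ≲-trans : ∀ {f g h} → f ≲ g → g ≲ h → f ≲ h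
  ≲-trans {f} {g} {h} f≲g g≲h k =
    let N₀ , p = ≲-+ f≲g g≲h k
    in N₀ , λ N N₀≤N → ℕ.+-cancelˡ-≤ (k * g N) _ _ (begin
    k * g N + k * f N         ≡⟨ swap k (g N) (f N) ⟩
    k * (f N + g N)           ≤⟨ p N N₀≤N ⟩
    k * (g N + h N) + N       ≡⟨ assoc k (g N) (h N) N ⟩
    k * g N + (k * h N + N)   ∎)
    where
    swap : ∀ k a b → k * a + k * b ≡ k * (b + a)
    swap = solve-∀
    assoc : ∀ k a b n → k * (a + b) + n ≡ k * a + (k * b + n)
    assoc = solve-∀

  ≲-sum : ∀ n {f g : ℕ → ℕ → ℕ} → (∀ i → f i ≲ g i) →
    (λ N → sum< n (λ i → f i N)) ≲ (λ N → sum< n (λ i → g i N))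
  ≲-sum zero    f≲g = ≤⇒≲ λ _ → z≤n
  ≲-sum (suc n) f≲g = ≲-+ (f≲g 0) (≲-sum n (f≲g ∘ suc))

  ≲-unscale : ∀ c .{{_ : NonZero c}} {f g} → (λ N → c * f N) ≲ (λ N → c * g N) → f ≲ g
  ≲-unscale c {f} {g} cf≲cg k =
    let N₀ , h = cf≲cg k
    in N₀ , λ N N₀≤N → ℕ.*-cancelˡ-≤ c (begin
    c * (k * f N)       ≡⟨ comm c k (f N) ⟩
    k * (c * f N)       ≤⟨ h N N₀≤N ⟩
    k * (c * g N) + N   ≤⟨ ℕ.+-monoʳ-≤ (k * (c * g N)) (ℕ.m≤n*m N c) ⟩
    k * (c * g N) + c * N ≡⟨ factor c k (g N) N ⟩
    c * (k * g N + N)   ∎)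
    where
    comm : ∀ c k a → c * (k * a) ≡ k * (c * a)
    comm = solve-∀
    factor : ∀ c k a n → k * (c * a) + c * n ≡ c * (k * a + n)
    factor = solve-∀

  -- Bernoulli's inequality for (1 + 1/n)ʲ, without division.
  *-^-suc-bound : ∀ n j → j * n ^ j ≤ suc n ^ suc j
  *-^-suc-bound n zero    = z≤n
  *-^-suc-bound n (suc j) = begin
    suc j * (n * n ^ j)                         ≡⟨ split j n (n ^ j) ⟩
    n * n ^ j + n * (j * n ^ j)                 ≤⟨ ℕ.+-mono-≤ (ℕ.^-monoˡ-≤ (suc j) (ℕ.n≤1+n n))
                                                             (ℕ.*-monoʳ-≤ n (*-^-suc-bound n j)) ⟩
    suc n ^ suc j + n * suc n ^ suc j           ∎
    where
    split : ∀ j n p → suc j * (n * p) ≡ n * p + n * (j * p)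
    split = solve-∀

  -- The function `w` on blocks of base `q` digits.

  sum-map-upTo-suc : ∀ (f : ℕ → ℕ) n → List.sum (map f (upTo (suc n))) ≡ List.sum (map f (upTo n)) + f n
  sum-map-upTo-suc f n = begin-equality
    List.sum (map f (upTo (suc n)))          ≡⟨ cong (List.sum ∘ map f) (upTo-∷ʳ n) ⟨
    List.sum (map f (upTo n ++ [ n ]))       ≡⟨ cong List.sum (map-++ f (upTo n) [ n ]) ⟩
    List.sum (map f (upTo n) ++ [ f n ])     ≡⟨ sum-++ (map f (upTo n)) [ f n ] ⟩
    List.sum (map f (upTo n)) + (f n + 0)    ≡⟨ cong (List.sum (map f (upTo n)) +_) (ℕ.+-identityʳ (f n)) ⟩
    List.sum (map f (upTo n)) + f n          ∎

  module Valuation {q} (2≤q : 2 ≤ q) where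

    instance
      q-nonZero : NonZero q
      q-nonZero = >-nonZero (ℕ.<⇒≤ 2≤q)

    v-∤ : ∀ {n} → ¬ q ℕ.∣ n → v q n ≡ 0
    v-∤ {n} q∤n with v q n | v-divides q n
    ... | zero  | _  = refl
    ... | suc k | qᵏ⁺¹∣n = contradiction (ℕ.∣-trans (ℕ.m∣m*n (q ^ k)) qᵏ⁺¹∣n) q∤n

    v-* : ∀ {n} → 0 < n → v q (q * n) ≡ suc (v q n)
    v-* {n} 0<n = ℕ.≤-antisym upper (v-greatest 2≤q 0<qn (ℕ.*-monoʳ-∣ q (v-divides q n)))
      where
      0<qn : 0 < q * n
      0<qn = ℕ.<-≤-trans 0<n (ℕ.m≤n*m n q)
      upper : v q (q * n) ≤ suc (v q n)
      upper with v q (q * n) | v-divides q (q * n)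
      ... | zero  | _      = z≤n
      ... | suc k | q∣ = s≤s (v-greatest 2≤q 0<n (ℕ.*-cancelˡ-∣ q q∣))

    w-suc : ∀ n → w q (suc n) ≡ w q n + v q (suc n)
    w-suc n = sum-map-upTo-suc (v q) (suc n)

    -- None of `q * m + 1`, ..., `q * m + r` is divisible by `q`, so their valuations add nothing.
    w-*+ : ∀ m r → r < q → w q (q * m + r) ≡ w q (q * m)
    w-*+ m zero    r<q  = cong (w q) (ℕ.+-identityʳ (q * m))
    w-*+ m (suc r) r+1<q = begin-equality
      w q (q * m + suc r)                 ≡⟨ cong (w q) (ℕ.+-suc (q * m) r) ⟩
      w q (suc (q * m + r))               ≡⟨ w-suc (q * m + r) ⟩
      w q (q * m + r) + v q (suc (q * m + r)) ≡⟨ cong₂ _+_ (w-*+ m r (ℕ.<-trans (ℕ.n<1+n r) r+1<q)) (v-∤ q∤) ⟩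
      w q (q * m) + 0                     ≡⟨ ℕ.+-identityʳ _ ⟩
      w q (q * m)                         ∎
      where
      q∤ : ¬ q ℕ.∣ suc (q * m + r)
      q∤ q∣ = ℕ.<⇒≱ r+1<q (ℕ.∣⇒≤ (ℕ.∣m+n∣m⇒∣n (subst (q ℕ.∣_) (sym (ℕ.+-suc (q * m) r)) q∣) (ℕ.m∣m*n m)))

    -- Up to `q * m` only the multiples `q * i` with `0 < i ≤ m` contribute, and each contributes
    -- `v q i + 1`.
    w-* : ∀ m → w q (q * m) ≡ w q m + m
    w-* zero    = cong (w q) (ℕ.*-zeroʳ q)
    w-* (suc m) = begin-equality
      w q (q * suc m)                                      ≡⟨ cong (w q) eq ⟨
      w q (suc (q * m + ℕ.pred q))                         ≡⟨ w-suc (q * m + ℕ.pred q) ⟩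
      w q (q * m + ℕ.pred q) + v q (suc (q * m + ℕ.pred q)) ≡⟨ cong₂ _+_ (w-*+ m _ (ℕ.≤-reflexive (ℕ.suc-pred q))) (trans (cong (v q) eq) (v-* (s≤s z≤n))) ⟩
      w q (q * m) + suc (v q (suc m))                      ≡⟨ cong (_+ suc (v q (suc m))) (w-* m) ⟩
      w q m + m + suc (v q (suc m))                        ≡⟨ rearrange (w q m) m (v q (suc m)) ⟩
      w q m + v q (suc m) + suc m                          ≡⟨ cong (_+ suc m) (w-suc m) ⟨
      w q (suc m) + suc m                                  ∎
      where
      eq : suc (q * m + ℕ.pred q) ≡ q * suc m
      eq = trans (sym (ℕ.+-suc (q * m) (ℕ.pred q)))
        (trans (cong (q * m +_) (ℕ.suc-pred q)) (trans (ℕ.+-comm (q * m) q) (sym (ℕ.*-suc q m))))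
      rearrange : ∀ a m b → a + m + suc b ≡ a + b + suc m
      rearrange = solve-∀

    w-digit : ∀ {r} → r < q → w q r ≡ 0
    w-digit {r} r<q = trans (cong (λ z → w q (z + r)) (sym (ℕ.*-zeroʳ q)))
      (trans (w-*+ 0 r r<q) (cong (w q) (ℕ.*-zeroʳ q)))

    w-*+′ : ∀ m {r} → r < q → w q (q * m + r) ≡ w q m + m
    w-*+′ m {r} r<q = trans (w-*+ m r r<q) (w-* m)

    repunit : ℕ → ℕ
    repunit zero    = 0
    repunit (suc L) = suc (q * repunit L)

    ^≡1+[q-1]*repunit : ∀ L → q ^ L ≡ suc (ℕ.pred q * repunit L)
    ^≡1+[q-1]*repunit zero    = cong suc (sym (ℕ.*-zeroʳ (ℕ.pred q)))
    ^≡1+[q-1]*repunit (suc L) = begin-equality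
      q * q ^ L                                  ≡⟨ cong₂ _*_ (sym (ℕ.suc-pred q)) (^≡1+[q-1]*repunit L) ⟩
      suc p * suc (p * repunit L)                ≡⟨ shift p (repunit L) ⟩
      suc (p * suc (suc p * repunit L))          ≡⟨ cong (λ z → suc (p * suc (z * repunit L))) (ℕ.suc-pred q) ⟩
      suc (p * suc (q * repunit L))              ∎
      where
      p = ℕ.pred q
      shift : ∀ p R → suc p * suc (p * R) ≡ suc (p * suc (suc p * R))
      shift = solve-∀

    -- Induction on `L`: the leading digit `r` of `s` moves over to `m`, and the hypothesis applies
    -- to `q * m + r` with the shorter block `s′`. A second use of it, with `r` in place of `m`,
    -- reassembles `w q s`; there the digit `r` has `w q r ≡ 0`.
    w-block : ∀ L m {s} → s < q ^ L → w q (q ^ L * m + s) ≡ w q m + repunit L * m + w q s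
    w-block zero    m {zero} _ = trans (cong (w q) (trans (ℕ.+-identityʳ _) (ℕ.+-identityʳ m)))
      (sym (trans (ℕ.+-identityʳ _) (ℕ.+-identityʳ _)))
    w-block zero    m {suc s} (s≤s ())
    w-block (suc L) m {s} s<q^L+1 = begin-equality
      w q (q * q ^ L * m + s)                                         ≡⟨ cong (λ z → w q (q * q ^ L * m + z)) s≡ ⟩
      w q (q * q ^ L * m + (q ^ L * r + s′))                          ≡⟨ cong (w q) (regroup q (q ^ L) m r s′) ⟩
      w q (q ^ L * (q * m + r) + s′)                                  ≡⟨ w-block L (q * m + r) s′<q^L ⟩
      w q (q * m + r) + repunit L * (q * m + r) + w q s′              ≡⟨ cong (λ z → z + repunit L * (q * m + r) + w q s′) (w-*+′ m r<q) ⟩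
      w q m + m + repunit L * (q * m + r) + w q s′                    ≡⟨ distribute (w q m) m (repunit L) q r (w q s′) ⟩
      w q m + suc (q * repunit L) * m + (0 + repunit L * r + w q s′)  ≡⟨ cong (λ z → w q m + suc (q * repunit L) * m + (z + repunit L * r + w q s′)) (w-digit r<q) ⟨
      w q m + suc (q * repunit L) * m + (w q r + repunit L * r + w q s′) ≡⟨ cong (w q m + suc (q * repunit L) * m +_) (w-block L r s′<q^L) ⟨
      w q m + suc (q * repunit L) * m + w q (q ^ L * r + s′)          ≡⟨ cong (λ z → w q m + suc (q * repunit L) * m + w q z) s≡ ⟨
      w q m + suc (q * repunit L) * m + w q s                         ∎
      where
      instance q^L-nonZero = ℕ.m^n≢0 q L
      r = s ℕ./ q ^ L
      s′ = s ℕ.% q ^ L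
      s≡ : s ≡ q ^ L * r + s′
      s≡ = trans (m≡m%n+[m/n]*n s (q ^ L)) (trans (ℕ.+-comm s′ _) (cong (_+ s′) (ℕ.*-comm r (q ^ L))))
      s′<q^L : s′ < q ^ L
      s′<q^L = m%n<n s (q ^ L)
      r<q : r < q
      r<q = m<n*o⇒m/o<n s<q^L+1
      regroup : ∀ q p m r s → q * p * m + (p * r + s) ≡ p * (q * m + r) + s
      regroup = solve-∀
      distribute : ∀ a m R q r b → a + m + R * (q * m + r) + b ≡ a + suc (q * R) * m + (0 + R * r + b)
      distribute = solve-∀

open import Data.Integer.Base using (ℤ; +_; -[1+_]; 0ℤ; _+_; _*_; _-_; -_)
import Data.Integer.Base as ℤ
open import Data.Integer.Divisibility.Signed
  using (_∣_; divides; ∣⇒∣ᵤ; ∣ᵤ⇒∣; ∣-refl; ∣-trans; ∣m∣n⇒∣m+n; ∣m∣n⇒∣m-n; ∣m⇒∣-m; ∣n⇒∣m*n; ∣m⇒∣m*n; ∣m+n∣m⇒∣n)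
import Data.Integer.GCD as ℤ
import Data.Integer.Properties as ℤ
open import Data.Integer.Tactic.RingSolver using (solve-∀)
import Data.Nat.Tactic.RingSolver as ℕSolver
import Data.Rational.Base as ℚ
open import Data.Rational.Base using (mkℚ; 0ℚ; _/_)
import Data.Rational.Properties as ℚ
import Data.Rational.Unnormalised.Base as ℚᵘ
import Data.Rational.Unnormalised.Properties as ℚᵘ

-- Indicators, counting and residues.

𝟙 : ∀ {a} {A : Set a} → Dec A → ℕ
𝟙 A? = if does A? then 1 else 0

𝟙-cong : ∀ {a b} {A : Set a} {B : Set b} (A? : Dec A) (B? : Dec B) →
  (A → B) → (B → A) → 𝟙 A? ≡ 𝟙 B?
𝟙-cong (yes _) (yes _) _   _   = refl
𝟙-cong (yes a) (no ¬b) a⇒b _   = contradiction (a⇒b a) ¬b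
𝟙-cong (no ¬a) (yes b) _   b⇒a = contradiction (b⇒a b) ¬a
𝟙-cong (no _)  (no _)  _   _   = refl

𝟙≤1 : ∀ {a} {A : Set a} (A? : Dec A) → 𝟙 A? ≤ 1
𝟙≤1 (yes _) = ℕ.≤-refl
𝟙≤1 (no _)  = z≤n

count≡sum : ∀ {ℓ} {T : Pred ℕ ℓ} (T? : Decidable T) N → count T? N ≡ sum< N (𝟙 ∘ T?)
count≡sum T? = go id
  where
  -- `upTo` is `applyUpTo id`, whose tail applies `id ∘ suc`; the induction therefore runs over all
  -- `f`.
  go : ∀ f N → length (filter T? (applyUpTo f N)) ≡ sum< N (𝟙 ∘ T? ∘ f)
  go f zero = refl
  go f (suc N) with does (T? (f 0))
  ... | true  = cong suc (go (f ∘ suc) N)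
  ... | false = go (f ∘ suc) N

%-≡⇒∣ : ∀ {m n d} .{{_ : NonZero d}} → m ℕ.% d ≡ n ℕ.% d → + d ∣ + m - + n
%-≡⇒∣ {m} {n} {d} eq = divides (+ (m ℕ./ d) - + (n ℕ./ d)) (begin
  + m - + n                                                         ≡⟨ cong₂ _-_ (decompose m) (trans (decompose n) (cong (λ r → + r + + (n ℕ./ d) * + d) (sym eq))) ⟩
  (r + + (m ℕ./ d) * + d) - (r + + (n ℕ./ d) * + d)                 ≡⟨ cancel r (+ (m ℕ./ d)) (+ (n ℕ./ d)) (+ d) ⟩
  (+ (m ℕ./ d) - + (n ℕ./ d)) * + d                                 ∎)
  where
  open ≡-Reasoning
  r = + (m ℕ.% d)
  decompose : ∀ m → + m ≡ + (m ℕ.% d) + + (m ℕ./ d) * + d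
  decompose m = trans (cong +_ (m≡m%n+[m/n]*n m d)) (cong (λ z → + (m ℕ.% d) + z) (ℤ.pos-* (m ℕ./ d) d))
  cancel : ∀ r a b d → (r + a * d) - (r + b * d) ≡ (a - b) * d
  cancel = solve-∀

-- Congruent blocks with prescribed difference of `w`.

module Swaps (p : ℕ) (2≤q : 2 ≤ suc p) (d : ℕ) {{_ : NonZero d}} where

  open Valuation 2≤q

  private q = suc p

  -- The bounds make `s` and `t` admissible low blocks in `w-block`; leading zeros are allowed.
  Swap : ℕ → ℕ → Set
  Swap L δ = ∃₂ λ s t → s < q ℕ.^ L × t < q ℕ.^ L ×
    + d ∣ + t - + s × + d ∣ + w q t - (+ w q s + + δ)

  w-blockℤ : ∀ L m {s} → s < q ℕ.^ L →
    + w q (q ℕ.^ L ℕ.* m ℕ.+ s) ≡ + w q m + + repunit L * + m + + w q s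
  w-blockℤ L m {s} s< = trans (cong +_ (w-block L m s<))
    (cong (λ z → + w q m + z + + w q s) (ℤ.pos-* (repunit L) m))

  concat< : ∀ {P P′ m s} → m < P′ → s < P → P ℕ.* m ℕ.+ s < P ℕ.* P′
  concat< {P} {P′} {m} {s} m<P′ s<P = begin-strict
    P ℕ.* m ℕ.+ s <⟨ ℕ.+-monoʳ-< (P ℕ.* m) s<P ⟩
    P ℕ.* m ℕ.+ P ≡⟨ trans (ℕ.+-comm (P ℕ.* m) P) (sym (ℕ.*-suc P m)) ⟩
    P ℕ.* suc m   ≤⟨ ℕ.*-monoʳ-≤ P m<P′ ⟩
    P ℕ.* P′      ∎
    where open ℕ.≤-Reasoning

  swap-0 : Swap 0 0
  swap-0 = 0 , 0 , s≤s z≤n , s≤s z≤n , divides 0ℤ refl , divides 0ℤ (ℤ.+-inverseʳ (+ w q 0))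

  -- The blocks are concatenated, with the primed ones on top. By `w-block` the differences of `w`
  -- add up, apart from `repunit L * (t′ - s′)`, which is divisible by `d`.
  swap-+ : ∀ {L δ L′ δ′} → Swap L δ → Swap L′ δ′ → Swap (L ℕ.+ L′) (δ ℕ.+ δ′)
  swap-+ {L} {δ} {L′} {δ′} (s , t , s< , t< , d∣ , d∣w) (s′ , t′ , s′< , t′< , d∣′ , d∣w′) =
    P ℕ.* s′ ℕ.+ s , P ℕ.* t′ ℕ.+ t ,
    subst (_ <_) (sym P*P′) (concat< s′< s<) , subst (_ <_) (sym P*P′) (concat< t′< t<) ,
    subst (+ d ∣_) (sym eq) (∣m∣n⇒∣m+n (∣n⇒∣m*n (+ P) d∣′) d∣) ,
    subst (+ d ∣_) (sym eqw) (∣m∣n⇒∣m+n (∣m∣n⇒∣m+n d∣w′ (∣n⇒∣m*n (+ repunit L) d∣′)) d∣w)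
    where
    P = q ℕ.^ L
    P*P′ : q ℕ.^ (L ℕ.+ L′) ≡ P ℕ.* q ℕ.^ L′
    P*P′ = ℕ.^-distribˡ-+-* q L L′
    ring : ∀ P t′ t s′ s → (P * t′ + t) - (P * s′ + s) ≡ P * (t′ - s′) + (t - s)
    ring = solve-∀
    eq : + (P ℕ.* t′ ℕ.+ t) - + (P ℕ.* s′ ℕ.+ s) ≡ + P * (+ t′ - + s′) + (+ t - + s)
    eq = trans (cong₂ (λ a b → (a + + t) - (b + + s)) (ℤ.pos-* P t′) (ℤ.pos-* P s′))
               (ring (+ P) (+ t′) (+ t) (+ s′) (+ s))
    ringw : ∀ R wt′ t′ wt ws′ s′ ws δ δ′ →
      (wt′ + R * t′ + wt) - ((ws′ + R * s′ + ws) + (δ + δ′)) ≡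
      (wt′ - (ws′ + δ′)) + R * (t′ - s′) + (wt - (ws + δ))
    ringw = solve-∀
    eqw : + w q (P ℕ.* t′ ℕ.+ t) - (+ w q (P ℕ.* s′ ℕ.+ s) + + (δ ℕ.+ δ′)) ≡
      (+ w q t′ - (+ w q s′ + + δ′)) + + repunit L * (+ t′ - + s′) + (+ w q t - (+ w q s + + δ))
    eqw = trans (cong₂ (λ a b → a - (b + (+ δ + + δ′))) (w-blockℤ L t′ t<) (w-blockℤ L s′ s<))
      (ringw (+ repunit L) (+ w q t′) (+ t′) (+ w q t) (+ w q s′) (+ s′) (+ w q s) (+ δ) (+ δ′))

  -- If R i ≡ R j (mod d) with i < j, then also q^i ≡ q^j, and t = q^(i+1) and
  -- s = (q - 1) q^i + q^j are congruent, while w t - w s ≡ R (i+1) - q R i = 1.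
  swap-1 : ∃ λ L → Swap L 1
  swap-1 with pigeonhole (ℕ.n<1+n d) (λ i → fromℕ< (m%n<n (repunit (toℕ i)) d))
  -- The pigeonhole principle is applied to the `d + 1` repunits with indices 0 to `d`.
  ... | i′ , j′ , i<j , eq = suc j , s , t , s< , t< ,
    subst (+ d ∣_) (sym t-s) (∣n⇒∣m*n (+ p) d∣) ,
    subst (+ d ∣_) (sym wt-ws) d∣
    where
    i = toℕ i′
    j = toℕ j′
    Rᵢ = repunit i
    Rⱼ = repunit j
    d∣ : + d ∣ + Rᵢ - + Rⱼ
    d∣ = %-≡⇒∣ (fromℕ<-injective _ _ _ _ eq)
    -- The factors 1 and the summands 0 bring these numbers into the shape required by `w-block`.
    r = q ℕ.^ i ℕ.* p ℕ.+ 0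
    s = q ℕ.^ j ℕ.* 1 ℕ.+ r
    t = q ℕ.^ suc i ℕ.* 1 ℕ.+ 0
    0<q^ : ∀ k → 0 < q ℕ.^ k
    0<q^ k = ℕ.m^n>0 q k
    r<q^j : r < q ℕ.^ j
    r<q^j = ℕ.<-≤-trans (concat< (ℕ.n<1+n p) (0<q^ i))
      (ℕ.≤-trans (ℕ.≤-reflexive (ℕ.*-comm (q ℕ.^ i) q)) (ℕ.^-monoʳ-≤ q i<j))
    s< : s < q ℕ.^ suc j
    s< = subst (s <_) (ℕ.*-comm (q ℕ.^ j) q) (concat< 2≤q r<q^j)
    t< : t < q ℕ.^ suc j
    t< = ℕ.<-≤-trans (concat< 2≤q (0<q^ (suc i)))
      (ℕ.≤-trans (ℕ.≤-reflexive (ℕ.*-comm (q ℕ.^ suc i) q)) (ℕ.*-monoʳ-≤ q (ℕ.^-monoʳ-≤ q i<j)))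
    w-digitℤ : ∀ {a} → a < q → + w q a ≡ 0ℤ
    w-digitℤ a<q = cong +_ (w-digit a<q)
    wr : + w q r ≡ + Rᵢ * + p
    wr = trans (w-blockℤ i p (0<q^ i)) (trans (cong (λ z → z + + Rᵢ * + p + 0ℤ) (w-digitℤ (ℕ.n<1+n p)))
      (trans (ℤ.+-identityʳ _) (ℤ.+-identityˡ _)))
    ws : + w q s ≡ 0ℤ + + Rⱼ * + 1 + + Rᵢ * + p
    ws = trans (w-blockℤ j 1 r<q^j) (cong₂ (λ a b → a + + Rⱼ * + 1 + b) (w-digitℤ 2≤q) wr)
    wt : + w q t ≡ 0ℤ + (+ 1 + (+ 1 + + p) * + Rᵢ) * + 1 + 0ℤ
    wt = trans (w-blockℤ (suc i) 1 (0<q^ (suc i)))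
      (cong₂ (λ a b → a + (+ 1 + b) * + 1 + 0ℤ) (w-digitℤ 2≤q) (ℤ.pos-* q Rᵢ))
    wring : ∀ p R R′ → (0ℤ + (+ 1 + (+ 1 + p) * R) * + 1 + 0ℤ) - ((0ℤ + R′ * + 1 + R * p) + + 1) ≡ R - R′
    wring = solve-∀
    wt-ws : + w q t - (+ w q s + + 1) ≡ + Rᵢ - + Rⱼ
    wt-ws = trans (cong₂ (λ a b → a - (b + + 1)) wt ws) (wring (+ p) (+ Rᵢ) (+ Rⱼ))
    ^ℤ : ∀ k → + (q ℕ.^ k) ≡ + 1 + + p * + repunit k
    ^ℤ k = trans (cong +_ (^≡1+[q-1]*repunit k)) (cong (λ z → + 1 + z) (ℤ.pos-* p (repunit k)))
    -- Here `t - s` is `q ^ i - q ^ j`, and each power is `1 + p * R` with its repunit `R`.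
    sring : ∀ p R R′ → ((+ 1 + p) * (+ 1 + p * R) * + 1 + 0ℤ) - ((+ 1 + p * R′) * + 1 + ((+ 1 + p * R) * p + 0ℤ)) ≡ p * (R - R′)
    sring = solve-∀
    t≡ : + t ≡ (+ 1 + + p) * (+ 1 + + p * + Rᵢ) * + 1 + 0ℤ
    t≡ = cong (_+ 0ℤ) (trans (ℤ.pos-* (q ℕ.* q ℕ.^ i) 1) (cong (_* + 1) (trans (ℤ.pos-* q (q ℕ.^ i)) (cong (λ z → + q * z) (^ℤ i)))))
    s≡ : + s ≡ (+ 1 + + p * + Rⱼ) * + 1 + ((+ 1 + + p * + Rᵢ) * + p + 0ℤ)
    s≡ = cong₂ (λ a b → a + (b + 0ℤ))
      (trans (ℤ.pos-* (q ℕ.^ j) 1) (cong (_* + 1) (^ℤ j)))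
      (trans (ℤ.pos-* (q ℕ.^ i) p) (cong (_* + p) (^ℤ i)))
    t-s : + t - + s ≡ + p * (+ Rᵢ - + Rⱼ)
    t-s = trans (cong₂ _-_ t≡ s≡) (sring (+ p) (+ Rᵢ) (+ Rⱼ))

  swap-* : ∀ n {L δ} → Swap L δ → Swap (n ℕ.* L) (n ℕ.* δ)
  swap-* zero    σ = swap-0
  swap-* (suc n) {L} {δ} σ = swap-+ {L} {δ} {n ℕ.* L} {n ℕ.* δ} σ (swap-* n σ)

  swap-mono : ∀ {L L′ δ} → L ≤ L′ → Swap L δ → Swap L′ δ
  swap-mono L≤L′ (s , t , s< , t< , rest) =
    s , t , ℕ.<-≤-trans s< (ℕ.^-monoʳ-≤ q L≤L′) , ℕ.<-≤-trans t< (ℕ.^-monoʳ-≤ q L≤L′) , rest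

  -- Only `δ` mod `d` matters, and its residue `k < d` is reached by `k` copies of `swap-1`, which
  -- fit into `d * L` digits. A length common to all `δ` lets the contraction work with one block
  -- size.
  swap-all : ∃ λ L → ∀ δ → Swap L δ
  swap-all = let L , σ = swap-1 in d ℕ.* L , λ δ →
    let k = δ ℕ.% d
        s , t , s< , t< , d∣ , d∣w =
          swap-mono {k ℕ.* L} {d ℕ.* L} {k ℕ.* 1} (ℕ.*-monoˡ-≤ L (ℕ.<⇒≤ (m%n<n δ d))) (swap-* k {L} σ)
    in s , t , s< , t< , d∣ ,
      subst (+ d ∣_) (shift (+ w q t) (+ w q s) (+ k) (+ δ))
        (∣m∣n⇒∣m+n (subst (λ z → + d ∣ + w q t - (+ w q s + + z)) (ℕ.*-identityʳ k) d∣w)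
          (%-≡⇒∣ {k} {δ} {d} (m%n%n≡m%n δ d)))
    where
    shift : ∀ a b x y → (a - (b + x)) + (x - y) ≡ a - (b + y)
    shift = solve-∀

-- Counting solutions, and contraction under shifts by multiples of `ψ`.

module Counting (d : ℕ) {{_ : NonZero d}} (W : ℕ → ℕ) (ψ : ℤ) where

  hit : ℤ → ℕ
  hit y = 𝟙 (d ℕ.∣? ℤ.∣ y ∣)

  hit-cong : ∀ y z → + d ∣ y - z → hit y ≡ hit z
  hit-cong y z d∣y-z = 𝟙-cong (d ℕ.∣? ℤ.∣ y ∣) (d ℕ.∣? ℤ.∣ z ∣)
    (λ d∣y → ∣⇒∣ᵤ (subst (+ d ∣_) (right y z) (∣m∣n⇒∣m-n (∣ᵤ⇒∣ {+ d} {y} d∣y) d∣y-z)))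
    (λ d∣z → ∣⇒∣ᵤ (subst (+ d ∣_) (left y z) (∣m∣n⇒∣m+n d∣y-z (∣ᵤ⇒∣ {+ d} {z} d∣z))))
    where
    right : ∀ y z → y - (y - z) ≡ z
    right = solve-∀
    left : ∀ y z → (y - z) + z ≡ y
    left = solve-∀

  value : ℤ → ℤ → ℕ → ℤ
  value θ x n = ψ * + W n + θ * + n + x

  hits : ℤ → ℤ → ℕ → ℕ
  hits θ x N = sum< N (hit ∘ value θ x)

  hits-cong : ∀ θ {x y} → + d ∣ x - y → ∀ N → hits θ x N ≡ hits θ y N
  hits-cong θ {x} {y} d∣x-y N = sum<-cong N λ n →
    hit-cong (value θ x n) (value θ y n) (subst (+ d ∣_) (cancel (ψ * + W n + θ * + n) x y) d∣x-y)
    where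
    cancel : ∀ a x y → x - y ≡ (a + x) - (a + y)
    cancel = solve-∀

  hits-cong-≡ : ∀ θ {x y} → x ≡ y → ∀ N → hits θ x N ≡ hits θ y N
  hits-cong-≡ θ x≡y N = cong (λ z → hits θ z N) x≡y

  sum-hit≤ : ∀ N (f : ℕ → ℤ) → sum< N (hit ∘ f) ≤ N
  sum-hit≤ N f = begin
    sum< N (hit ∘ f)    ≤⟨ sum-mono-≤ {N} (λ i → 𝟙≤1 (d ℕ.∣? _)) ⟩
    sum< N (λ _ → 1)    ≡⟨ sum-const N 1 ⟩
    N ℕ.* 1             ≡⟨ ℕ.*-identityʳ N ⟩
    N                   ∎
    where open ℕ.≤-Reasoning

  module _ (Q′ R : ℕ)
    (W-block : ∀ m {s} → s < suc Q′ → W (suc Q′ ℕ.* m ℕ.+ s) ≡ W m ℕ.+ R ℕ.* m ℕ.+ W s)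
    (swap : ∀ δ → ∃₂ λ s t → s < suc Q′ × t < suc Q′ ×
      + d ∣ + t - + s × + d ∣ + W t - (+ W s + + δ))
    where

    private Q = suc Q′

    -- The term `R * m` of the block law is absorbed by the new slope `θ * Q + ψ * R`, and the low
    -- block by the constant term. Each count on the right is thus of the same kind, but with
    -- another `θ`, so inductions on blocks must let `θ` vary.
    hits-block : ∀ θ x M → hits θ x (M ℕ.* Q) ≡
      sum {Q} (λ i → hits (θ * + Q + ψ * + R) (x + ψ * + W (toℕ i) + θ * + toℕ i) M)
    hits-block θ x M = trans (sum<-* M Q (hit ∘ value θ x)) (trans (sum<-comm M Q (λ m s → hit (value θ x (m ℕ.* Q ℕ.+ s))))
      (sum-cong-≗ {Q} λ i → sum<-cong M λ m → cong hit (term m (toℕ i) (toℕ<n i))))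
      where
      ring : ∀ ψ θ x Q R Wm m Ws s →
        ψ * (Wm + R * m + Ws) + θ * (m * Q + s) + x ≡
        ψ * Wm + (θ * Q + ψ * R) * m + (x + ψ * Ws + θ * s)
      ring = solve-∀
      term : ∀ m s → s < Q →
        ψ * + W (m ℕ.* Q ℕ.+ s) + θ * + (m ℕ.* Q ℕ.+ s) + x ≡
        ψ * + W m + (θ * + Q + ψ * + R) * + m + (x + ψ * + W s + θ * + s)
      term m s s<Q = trans
        (cong₂ (λ a b → ψ * a + θ * b + x)
          (trans (cong (λ z → + W (z ℕ.+ s)) (ℕ.*-comm m Q))
            (trans (cong +_ (W-block m s<Q)) (cong (λ z → + W m + z + + W s) (ℤ.pos-* R m))))
          (cong (λ z → z + + s) (ℤ.pos-* m Q)))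
        (ring ψ θ x (+ Q) (+ R) (+ W m) (+ m) (+ W s) (+ s))

    -- After the exchange of s and t, the block t of one side cancels exactly
    -- against the block s of the other, so only Q − 1 of the Q blocks remain.
    hits-contract : ∀ J M θ x δ →
      hits θ x (M ℕ.* Q ℕ.^ J) ≤ hits θ (x + ψ * + δ) (M ℕ.* Q ℕ.^ J) ℕ.+ M ℕ.* Q′ ℕ.^ J
    hits-contract zero    M θ x δ = ℕ.m≤n⇒m≤o+n _ (sum-hit≤ (M ℕ.* 1) (value θ x))
    hits-contract (suc J) M θ x δ = subst₂ (λ n e → hits θ x n ≤ hits θ (x + ψ * + δ) n ℕ.+ e)
      (size M Q (Q ℕ.^ J)) (error M Q′ (Q′ ℕ.^ J))
      (subst₂ (λ a b → a ≤ b ℕ.+ Q′ ℕ.* B) (sym (hits-block θ x M′)) (sym (hits-block θ (x + ψ * + δ) M′))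
        (exchange (swap δ)))
      where
      open ℕ.≤-Reasoning
      M′ = M ℕ.* Q ℕ.^ J
      B = M ℕ.* Q′ ℕ.^ J
      θ′ = θ * + Q + ψ * + R
      size : ∀ m q p → m ℕ.* p ℕ.* q ≡ m ℕ.* (q ℕ.* p)
      size = ℕSolver.solve-∀
      error : ∀ m q p → q ℕ.* (m ℕ.* p) ≡ m ℕ.* (q ℕ.* p)
      error = ℕSolver.solve-∀
      y : ℤ → ℕ → ℤ
      y x r = x + ψ * + W r + θ * + r
      a b : Fin Q → ℕ
      a i = hits θ′ (y x (toℕ i)) M′
      b i = hits θ′ (y (x + ψ * + δ) (toℕ i)) M′
      exchange : (∃₂ λ s t → s < Q × t < Q × + d ∣ + t - + s × + d ∣ + W t - (+ W s + + δ)) →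
        sum a ≤ sum b ℕ.+ Q′ ℕ.* B
      exchange (s , t , s<Q , t<Q , d∣ , d∣W) = sum-exchange a b (fromℕ< s<Q) (fromℕ< t<Q) B
        (λ r → ℕ.≤-trans (hits-contract J M θ′ (y x (toℕ r)) δ)
          (ℕ.≤-reflexive (cong (ℕ._+ B) (hits-cong-≡ θ′ (commute ψ θ x (+ δ) (+ W (toℕ r)) (+ toℕ r)) M′))))
        (ℕ.≤-reflexive at≡bs) as≤bt
        where
        commute : ∀ ψ θ x δ w r → x + ψ * w + θ * r + ψ * δ ≡ x + ψ * δ + ψ * w + θ * r
        commute = solve-∀
        diff : ∀ ψ θ x δ wt ws t s → ψ * (wt - (ws + δ)) + θ * (t - s) ≡
          (x + ψ * wt + θ * t) - (x + ψ * δ + ψ * ws + θ * s)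
        diff = solve-∀
        d∣y : + d ∣ y x t - y (x + ψ * + δ) s
        d∣y = subst (+ d ∣_) (diff ψ θ x (+ δ) (+ W t) (+ W s) (+ t) (+ s))
          (∣m∣n⇒∣m+n (∣n⇒∣m*n ψ d∣W) (∣n⇒∣m*n θ d∣))
        at≡bs : a (fromℕ< t<Q) ≡ b (fromℕ< s<Q)
        at≡bs = trans (cong (λ z → hits θ′ (y x z) M′) (toℕ-fromℕ< t<Q))
          (trans (hits-cong θ′ d∣y M′) (cong (λ z → hits θ′ (y (x + ψ * + δ) z) M′) (sym (toℕ-fromℕ< s<Q))))
        double : ∀ ψ θ x δ wt ws t s → - ((x + ψ * wt + θ * t) - (x + ψ * δ + ψ * ws + θ * s)) ≡
          (x + ψ * ws + θ * s + ψ * (δ + δ)) - (x + ψ * δ + ψ * wt + θ * t)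
        double = solve-∀
        -- Passing from block `s` to block `t` adds `ψ * δ` to the shift already present, so the
        -- induction hypothesis is needed for `δ + δ`.
        as≤bt : a (fromℕ< s<Q) ≤ b (fromℕ< t<Q) ℕ.+ B
        as≤bt = begin
          a (fromℕ< s<Q)                                     ≡⟨ cong (λ z → hits θ′ (y x z) M′) (toℕ-fromℕ< s<Q) ⟩
          hits θ′ (y x s) M′                                 ≤⟨ hits-contract J M θ′ (y x s) (δ ℕ.+ δ) ⟩
          hits θ′ (y x s + ψ * + (δ ℕ.+ δ)) M′ ℕ.+ B          ≡⟨ cong (ℕ._+ B) (hits-cong θ′ (subst (+ d ∣_) (double ψ θ x (+ δ) (+ W t) (+ W s) (+ t) (+ s)) (∣m⇒∣-m d∣y)) M′) ⟩
          hits θ′ (y (x + ψ * + δ) t) M′ ℕ.+ B                ≡⟨ cong (λ z → hits θ′ (y (x + ψ * + δ) z) M′ ℕ.+ B) (toℕ-fromℕ< t<Q) ⟨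
          b (fromℕ< t<Q) ℕ.+ B                                ∎

    -- `N` is cut into `M` full blocks of length `P = Q ^ J` and a remainder below `P`. The
    -- contraction error `M * Q′ ^ J` and the remainder are each at most `N / (2 k)`: the former by
    -- the choice of `J`, the latter once `N ≥ 2 * k * P`.
    hits-≲-ψ : ∀ θ x δ → hits θ x ≲ hits θ (x + ψ * + δ)
    hits-≲-ψ θ x δ k = 2 ℕ.* k ℕ.* P , bound
      where
      open ℕ.≤-Reasoning
      -- With this `J` the factor `Q` cancels in `*-^-suc-bound`, which leaves
      -- `2 * k * Q′ ^ J ≤ Q ^ J`.
      J = 2 ℕ.* k ℕ.* Q
      P = Q ℕ.^ J
      instance P-nonZero = ℕ.m^n≢0 Q J
      x′ = x + ψ * + δ
      small : 2 ℕ.* k ℕ.* Q′ ℕ.^ J ≤ P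
      small = ℕ.*-cancelˡ-≤ Q (begin
        Q ℕ.* (2 ℕ.* k ℕ.* Q′ ℕ.^ J) ≡⟨ move Q (2 ℕ.* k) (Q′ ℕ.^ J) ⟩
        J ℕ.* Q′ ℕ.^ J               ≤⟨ *-^-suc-bound Q′ J ⟩
        Q ℕ.* P                      ∎)
        where
        move : ∀ q k p → q ℕ.* (k ℕ.* p) ≡ k ℕ.* q ℕ.* p
        move = ℕSolver.solve-∀
      bound : ∀ N → 2 ℕ.* k ℕ.* P ≤ N → k ℕ.* hits θ x N ≤ k ℕ.* hits θ x′ N ℕ.+ N
      bound N 2kP≤N = begin
        k ℕ.* hits θ x N                                  ≤⟨ ℕ.*-monoʳ-≤ k hits≤ ⟩
        k ℕ.* (hits θ x′ N ℕ.+ E ℕ.+ P)                    ≡⟨ expand k (hits θ x′ N) E P ⟩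
        k ℕ.* hits θ x′ N ℕ.+ (k ℕ.* E ℕ.+ k ℕ.* P)          ≤⟨ ℕ.+-monoʳ-≤ (k ℕ.* hits θ x′ N) (ℕ.*-cancelˡ-≤ 2 error≤) ⟩
        k ℕ.* hits θ x′ N ℕ.+ N                            ∎
        where
        M = N ℕ./ P
        r = N ℕ.% P
        E = M ℕ.* Q′ ℕ.^ J
        N≡ : N ≡ M ℕ.* P ℕ.+ r
        N≡ = trans (m≡m%n+[m/n]*n N P) (ℕ.+-comm r (M ℕ.* P))
        split : ∀ z → hits θ z N ≡ hits θ z (M ℕ.* P) ℕ.+ sum< r (λ n → hit (value θ z (M ℕ.* P ℕ.+ n)))
        split z = trans (cong (hits θ z) N≡) (sum<-+ (M ℕ.* P) r (hit ∘ value θ z))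
        hits≤ : hits θ x N ≤ hits θ x′ N ℕ.+ E ℕ.+ P
        hits≤ = begin
          hits θ x N                      ≡⟨ split x ⟩
          hits θ x (M ℕ.* P) ℕ.+ _        ≤⟨ ℕ.+-mono-≤ (hits-contract J M θ x δ) (ℕ.≤-trans (sum-hit≤ r (λ n → value θ x (M ℕ.* P ℕ.+ n))) (ℕ.<⇒≤ (m%n<n N P))) ⟩
          hits θ x′ (M ℕ.* P) ℕ.+ E ℕ.+ P  ≤⟨ ℕ.+-monoˡ-≤ P (ℕ.+-monoˡ-≤ E (subst (hits θ x′ (M ℕ.* P) ≤_) (sym (split x′)) (ℕ.m≤m+n _ _))) ⟩
          hits θ x′ N ℕ.+ E ℕ.+ P          ∎
        expand : ∀ k a b c → k ℕ.* (a ℕ.+ b ℕ.+ c) ≡ k ℕ.* a ℕ.+ (k ℕ.* b ℕ.+ k ℕ.* c)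
        expand = ℕSolver.solve-∀
        regroup : ∀ k m e p → 2 ℕ.* (k ℕ.* (m ℕ.* e) ℕ.+ k ℕ.* p) ≡ m ℕ.* (2 ℕ.* k ℕ.* e) ℕ.+ 2 ℕ.* k ℕ.* p
        regroup = ℕSolver.solve-∀
        error≤ : 2 ℕ.* (k ℕ.* E ℕ.+ k ℕ.* P) ≤ 2 ℕ.* N
        error≤ = begin
          2 ℕ.* (k ℕ.* E ℕ.+ k ℕ.* P)                      ≡⟨ regroup k M (Q′ ℕ.^ J) P ⟩
          M ℕ.* (2 ℕ.* k ℕ.* Q′ ℕ.^ J) ℕ.+ 2 ℕ.* k ℕ.* P    ≤⟨ ℕ.+-mono-≤ (ℕ.*-monoʳ-≤ M small) 2kP≤N ⟩
          M ℕ.* P ℕ.+ N                                    ≤⟨ ℕ.+-monoˡ-≤ N (subst (M ℕ.* P ≤_) (sym N≡) (ℕ.m≤m+n _ r)) ⟩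
          N ℕ.+ N                                          ≡⟨ cong (N ℕ.+_) (ℕ.+-identityʳ N) ⟨
          2 ℕ.* N                                          ∎

  -- Averaging over a full cycle of shifts.

  module Cycle (h : ℤ) (n : ℕ) (d∣hn : + d ∣ h * + n) where

    cycle : ℤ → ℕ
    cycle y = sum< n (λ j → hit (h * + j + y))

    -- A shift by `h` rotates the `n` terms, because the terms at `j = n` and `j = 0` agree modulo
    -- `d`.
    cycle-+ : ∀ y m → cycle (y + h * + m) ≡ cycle y
    cycle-+ y zero    = cong cycle (trans (cong (λ z → y + z) (ℤ.*-zeroʳ h)) (ℤ.+-identityʳ y))
    cycle-+ y (suc m) = begin
      cycle (y + h * + suc m)  ≡⟨ sum<-cong n (λ j → cong hit (shift h (+ j) y (+ m))) ⟩
      sum< n (f ∘ suc)         ≡⟨ sum<-cyclic n f fn≡f0 ⟩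
      cycle y′                 ≡⟨ cycle-+ y m ⟩
      cycle y                  ∎
      where
      open ≡-Reasoning
      y′ = y + h * + m
      f : ℕ → ℕ
      f j = hit (h * + j + y′)
      shift : ∀ h j y m → h * j + (y + h * (+ 1 + m)) ≡ h * (+ 1 + j) + (y + h * m)
      shift = solve-∀
      period : ∀ h n y → h * n ≡ (h * n + y) - (h * + 0 + y)
      period = solve-∀
      fn≡f0 : f n ≡ f 0
      fn≡f0 = hit-cong (h * + n + y′) (h * + 0 + y′) (subst (+ d ∣_) (period h (+ n) y′) d∣hn)

    sum-hits-cycle : ∀ θ x N → sum< n (λ j → hits θ (x + h * + j) N) ≡ sum< N (cycle ∘ value θ x)
    sum-hits-cycle θ x N = trans (sum<-comm n N (λ j i → hit (value θ (x + h * + j) i)))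
      (sum<-cong N λ i → sum<-cong n λ j → cong hit (move (ψ * + W i + θ * + i) x (h * + j)))
      where
      move : ∀ a x b → a + (x + b) ≡ b + (a + x)
      move = solve-∀

  -- The shifts that preserve the count up to o(N).

  module Invariance (θ : ℤ) where

    -- A one-sided bound for all `x` is enough: the reverse bound is invariance under `- y`, which
    -- `inv-neg` supplies.
    Invariant : ℤ → Set
    Invariant y = ∀ x → hits θ x ≲ hits θ (x + y)

    inv-cong : ∀ y z → + d ∣ y - z → Invariant y → Invariant z
    inv-cong y z d∣y-z inv x = ≲-trans (inv x)
      (≲-reflexive (hits-cong θ (subst (+ d ∣_) (cancel x y z) d∣y-z)))
      where
      cancel : ∀ x y z → y - z ≡ (x + y) - (x + z)
      cancel = solve-∀

    inv-+ : ∀ y z → Invariant y → Invariant z → Invariant (y + z)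
    inv-+ y z invʸ invᶻ x = ≲-trans (invʸ x) (≲-trans (invᶻ (x + y))
      (≲-reflexive (hits-cong-≡ θ (ℤ.+-assoc x y z))))

    inv-* : ∀ y n → Invariant y → Invariant (y * + n)
    inv-* y zero    inv x = ≲-reflexive (hits-cong-≡ θ
      (sym (trans (cong (λ z → x + z) (ℤ.*-zeroʳ y)) (ℤ.+-identityʳ x))))
    inv-* y (suc n) inv = subst Invariant (sym (ℤ.*-suc y (+ n))) (inv-+ y (y * + n) inv (inv-* y n inv))

    -- Modulo `d`, `- y` is the sum of `d - 1` copies of `y`.
    inv-neg : ∀ y → Invariant y → Invariant (- y)
    inv-neg y inv = inv-cong (y * + ℕ.pred d) (- y) (divides y eq) (inv-* y (ℕ.pred d) inv)
      where
      collect : ∀ y p → y * p - - y ≡ y * (+ 1 + p)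
      collect = solve-∀
      eq : y * + ℕ.pred d - - y ≡ y * + d
      eq = trans (collect y (+ ℕ.pred d)) (cong (λ z → y * + z) (ℕ.suc-pred d))

    inv-abs : ∀ y → Invariant y → Invariant (+ ℤ.∣ y ∣)
    inv-abs y inv with ℤ.+∣i∣≡i⊎+∣i∣≡-i y
    ... | inj₁ eq = subst Invariant (sym eq) inv
    ... | inj₂ eq = subst Invariant (sym eq) (inv-neg y inv)

    combination : ∀ m n {g} a b → g ℕ.+ b ℕ.* n ≡ a ℕ.* m →
      Invariant (+ m) → Invariant (+ n) → Invariant (+ g)
    combination m n {g} a b eq invᵐ invⁿ = subst Invariant ma-nb
      (inv-+ _ _ (inv-* (+ m) a invᵐ) (inv-neg _ (inv-* (+ n) b invⁿ)))
      where
      open ≡-Reasoning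
      cancel : ∀ g b n → g + b * n - n * b ≡ g
      cancel = solve-∀
      ma-nb : + m * + a - + n * + b ≡ + g
      ma-nb = begin
        + m * + a - + n * + b          ≡⟨ cong (λ z → z - + n * + b) (trans (ℤ.*-comm (+ m) (+ a)) (sym (ℤ.pos-* a m))) ⟩
        + (a ℕ.* m) - + n * + b        ≡⟨ cong (λ z → + z - + n * + b) eq ⟨
        + g + + (b ℕ.* n) - + n * + b  ≡⟨ cong (λ z → + g + z - + n * + b) (ℤ.pos-* b n) ⟩
        + g + + b * + n - + n * + b    ≡⟨ cancel (+ g) (+ b) (+ n) ⟩
        + g                            ∎

    inv-gcd : ∀ m n → Invariant (+ m) → Invariant (+ n) → Invariant (+ ℕ.gcd m n)
    inv-gcd m n invᵐ invⁿ with ℕ.Bézout.identity (ℕ.gcd-GCD m n)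
    ... | ℕ.Bézout.+- a b eq = combination m n a b eq invᵐ invⁿ
    ... | ℕ.Bézout.-+ a b eq = combination n m b a eq invⁿ invᵐ

    module _ (h : ℤ) (n : ℕ) (d∣hn : + d ∣ h * + n) (inv : Invariant h) where
      open Cycle h n d∣hn

      -- Each of the `n` shifts of `x` by multiples of `h` has the same count up to o(N), so `n`
      -- times one count can be replaced by their sum.
      hits≲cycle : ∀ x → (λ N → n ℕ.* hits θ x N) ≲ (λ N → sum< N (cycle ∘ value θ x))
      hits≲cycle x = ≲-trans (≲-reflexive λ N → sym (sum-const n (hits θ x N)))
        (≲-trans (≲-sum n (λ j → inv-* h j inv x))
          (≲-reflexive (sum-hits-cycle θ x)))

      cycle≲hits : ∀ x → (λ N → sum< N (cycle ∘ value θ x)) ≲ (λ N → n ℕ.* hits θ x N)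
      cycle≲hits x = ≲-trans (≲-reflexive λ N → sym (sum-hits-cycle θ x N))
        (≲-trans (≲-sum n (λ j → ≲-trans (inv-neg _ (inv-* h j inv) (x + h * + j))
            (≲-reflexive (hits-cong-≡ θ (back x (h * + j))))))
          (≲-reflexive λ N → sum-const n (hits θ x N)))
        where
        back : ∀ x y → x + y + - y ≡ x
        back = solve-∀

    -- In the cycle of `d` shifts by `ψ`, the term `ψ * W i` is itself such a shift and drops out.
    -- What remains depends on `θ * i + x` alone, where replacing `x` by `x + θ` moves the index by
    -- one and costs at most one boundary term, bounded by `d`.
    inv-θ : Invariant ψ → Invariant θ
    inv-θ invψ x = ≲-unscale d (≲-trans (hits≲cycle ψ d d∣ψd invψ x)
      (≲-trans (≲-bounded d shift) (cycle≲hits ψ d d∣ψd invψ (x + θ))))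
      where
      open ℕ.≤-Reasoning
      d∣ψd : + d ∣ ψ * + d
      d∣ψd = ∣n⇒∣m*n ψ ∣-refl
      open Cycle ψ d d∣ψd
      f : ℕ → ℕ
      f i = cycle (θ * + i + x)
      drop-W : ∀ y i → cycle (value θ y i) ≡ cycle (θ * + i + y)
      drop-W y i = trans (cong cycle (move (ψ * + W i) (θ * + i) y)) (cycle-+ (θ * + i + y) (W i))
        where
        move : ∀ a b y → a + b + y ≡ b + y + a
        move = solve-∀
      next : ∀ i → f (suc i) ≡ cycle (θ * + i + (x + θ))
      next i = cong cycle (ring θ (+ i) x)
        where
        ring : ∀ θ i x → θ * (+ 1 + i) + x ≡ θ * i + (x + θ)
        ring = solve-∀
      shift : ∀ N → sum< N (cycle ∘ value θ x) ≤ sum< N (cycle ∘ value θ (x + θ)) ℕ.+ d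
      shift N = begin
        sum< N (cycle ∘ value θ x)                ≡⟨ sum<-cong N (drop-W x) ⟩
        sum< N f                                  ≤⟨ ℕ.m≤m+n (sum< N f) (f N) ⟩
        sum< N f ℕ.+ f N                          ≡⟨ sum<-suc N f ⟨
        f 0 ℕ.+ sum< N (f ∘ suc)                  ≡⟨ ℕ.+-comm (f 0) _ ⟩
        sum< N (f ∘ suc) ℕ.+ f 0                  ≤⟨ ℕ.+-monoʳ-≤ _ (sum-hit≤ d (λ j → ψ * + j + (θ * + 0 + x))) ⟩
        sum< N (f ∘ suc) ℕ.+ d                    ≡⟨ cong (ℕ._+ d) (sum<-cong N λ i → trans (next i) (sym (drop-W (x + θ) i))) ⟩
        sum< N (cycle ∘ value θ (x + θ)) ℕ.+ d    ∎

    inv-gcd₃ : Invariant ψ → Invariant (gcd₃ ψ θ (+ d))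
    inv-gcd₃ invψ = inv-gcd (ℕ.gcd ℤ.∣ ψ ∣ ℤ.∣ θ ∣) d
      (inv-gcd ℤ.∣ ψ ∣ ℤ.∣ θ ∣ (inv-abs ψ invψ) (inv-abs θ (inv-θ invψ)))
      -- A shift by `d` is a shift by 0 modulo `d`.
      (inv-cong 0ℤ (+ d) (∣m∣n⇒∣m-n (divides 0ℤ refl) ∣-refl) λ x → ≲-reflexive (hits-cong-≡ θ (sym (ℤ.+-identityʳ x))))

  -- Exact counts over a cycle when `d = h n`.

  hit-0 : hit 0ℤ ≡ 1
  hit-0 = cong (if_then 1 else 0) (dec-true (d ℕ.∣? 0) (d ℕ.∣0))

  hit-∤ : ∀ y → ¬ d ℕ.∣ ℤ.∣ y ∣ → hit y ≡ 0
  hit-∤ y d∤y = cong (if_then 1 else 0) (dec-false (d ℕ.∣? ℤ.∣ y ∣) d∤y)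

  module _ (h n : ℕ) (d≡hn : d ≡ h ℕ.* n) where

    private
      d∣hn : + d ∣ + h * + n
      d∣hn = subst (+ d ∣_) (trans (cong +_ d≡hn) (ℤ.pos-* h n)) ∣-refl
      instance
        h-nonZero : NonZero h
        h-nonZero = ℕ.m*n≢0⇒m≢0 h {{subst NonZero d≡hn it}}
        n-nonZero : NonZero n
        n-nonZero = ℕ.m*n≢0⇒n≢0 h {{subst NonZero d≡hn it}}

    open Cycle (+ h) n d∣hn

    -- Among the `h * j` with `j < n`, only 0 is divisible by `h * n`.
    cycle-0 : cycle 0ℤ ≡ 1
    cycle-0 = begin
      cycle 0ℤ                     ≡⟨ sum<-cong n (λ j → cong hit (trans (ℤ.+-identityʳ (+ h * + j)) (sym (ℤ.pos-* h j)))) ⟩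
      sum< n f                     ≡⟨ cong (λ n → sum< n f) (ℕ.suc-pred n) ⟨
      f 0 ℕ.+ sum< (ℕ.pred n) (f ∘ suc) ≡⟨ cong₂ ℕ._+_ (trans (cong (λ z → hit (+ z)) (ℕ.*-zeroʳ h)) hit-0) rest ⟩
      1                            ∎
      where
      open ≡-Reasoning
      f : ℕ → ℕ
      f j = hit (+ (h ℕ.* j))
      d∤ : ∀ (i : Fin (ℕ.pred n)) → ¬ d ℕ.∣ h ℕ.* suc (toℕ i)
      d∤ i d∣ = ℕ.<⇒≱ (ℕ.<-≤-trans (ℕ.s<s (toℕ<n i)) (ℕ.≤-reflexive (ℕ.suc-pred n)))
        (ℕ.∣⇒≤ (ℕ.*-cancelˡ-∣ h (subst (ℕ._∣ h ℕ.* suc (toℕ i)) d≡hn d∣)))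
      rest : sum< (ℕ.pred n) (f ∘ suc) ≡ 0
      rest = trans (sum-cong-≗ {ℕ.pred n} λ i → hit-∤ (+ (h ℕ.* suc (toℕ i))) (d∤ i))
        (trans (sum-const (ℕ.pred n) 0) (ℕ.*-zeroʳ (ℕ.pred n)))

    cycle-multiple : ∀ y → + h ∣ y → cycle y ≡ 1
    cycle-multiple _ (divides (+ k) refl) =
      trans (cong cycle (trans (ℤ.*-comm (+ k) (+ h)) (sym (ℤ.+-identityˡ _)))) (trans (cycle-+ 0ℤ k) cycle-0)
    cycle-multiple _ (divides -[1+ k ] refl) =
      trans (sym (cycle-+ (-[1+ k ] * + h) (suc k))) (trans (cong cycle (cancel (+ suc k) (+ h))) cycle-0)
      where
      cancel : ∀ k h → - k * h + h * k ≡ 0ℤ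
      cancel = solve-∀

    module _ (θ x : ℤ) (inv : Invariance.Invariant θ (+ h))
      (h∣ψ : + h ∣ ψ) (h∣θ : + h ∣ θ) (h∣x : + h ∣ x) where

      -- Every value is a multiple of `h`, so exactly one of its `n` shifts is divisible by `d`.
      sum-cycle : ∀ N → sum< N (cycle ∘ value θ x) ≡ N
      sum-cycle N = trans (sum<-cong N λ i → cycle-multiple (value θ x i)
          (∣m∣n⇒∣m+n (∣m∣n⇒∣m+n (∣m⇒∣m*n (+ W i) h∣ψ) (∣m⇒∣m*n (+ i) h∣θ)) h∣x))
        (trans (sum-const N 1) (ℕ.*-identityʳ N))

      hits≲N : (λ N → n ℕ.* hits θ x N) ≲ id
      hits≲N = ≲-trans (Invariance.hits≲cycle θ (+ h) n d∣hn inv x) (≲-reflexive sum-cycle)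

      N≲hits : id ≲ (λ N → n ℕ.* hits θ x N)
      N≲hits = ≲-trans (≲-reflexive (sym ∘ sum-cycle)) (Invariance.cycle≲hits θ (+ h) n d∣hn inv x)

  -- Each value is congruent to `x` modulo `h`, and a hit would force `h` to divide it.
  hits-∤ : ∀ θ x h → + h ∣ + d → + h ∣ ψ → + h ∣ θ → ¬ + h ∣ x → ∀ N → hits θ x N ≡ 0
  hits-∤ θ x h h∣d h∣ψ h∣θ h∤x N = trans (sum<-cong N λ i → hit-∤ (value θ x i) (d∤ i))
    (trans (sum-const N 0) (ℕ.*-zeroʳ N))
    where
    d∤ : ∀ i → ¬ d ℕ.∣ ℤ.∣ value θ x i ∣
    d∤ i d∣ = h∤x (∣m+n∣m⇒∣n (∣-trans h∣d (∣ᵤ⇒∣ {+ d} {value θ x i} d∣))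
      (∣m∣n⇒∣m+n (∣m⇒∣m*n (+ W i) h∣ψ) (∣m⇒∣m*n (+ i) h∣θ)))

-- From inequalities up to o(N) to rational densities.

∣+-+∣≤ : ∀ {a b e} → a ≤ b ℕ.+ e → b ≤ a ℕ.+ e → ℤ.∣ + a - + b ∣ ≤ e
∣+-+∣≤ {a} {b} {e} a≤b+e b≤a+e with ℕ.≤-total a b
... | inj₁ a≤b = begin
  ℤ.∣ + a - + b ∣  ≡⟨ cong ℤ.∣_∣ (ℤ.m-n≡m⊖n a b) ⟩
  ℤ.∣ a ℤ.⊖ b ∣   ≡⟨ ℤ.∣⊖∣-≤ a≤b ⟩
  b ℕ.∸ a          ≤⟨ ℕ.m≤n+o⇒m∸n≤o b a b≤a+e ⟩
  e                ∎
  where open ℕ.≤-Reasoning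
... | inj₂ b≤a = begin
  ℤ.∣ + a - + b ∣  ≡⟨ cong ℤ.∣_∣ (ℤ.m-n≡m⊖n a b) ⟩
  ℤ.∣ a ℤ.⊖ b ∣   ≡⟨ ℤ.∣m⊖n∣≡∣n⊖m∣ a b ⟩
  ℤ.∣ b ℤ.⊖ a ∣   ≡⟨ ℤ.∣⊖∣-≤ b≤a ⟩
  a ℕ.∸ b          ≤⟨ ℕ.m≤n+o⇒m∸n≤o a b a≤b+e ⟩
  e                ∎
  where open ℕ.≤-Reasoning

toℚᵘ-/ : ∀ n d .{{_ : NonZero d}} → ℚ.toℚᵘ (n / d) ℚᵘ.≃ n ℚᵘ./ d
toℚᵘ-/ n (suc d) = ℚ.toℚᵘ-fromℚᵘ (ℚᵘ.mkℚᵘ n d)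

toℚᵘ-∣-∣ : ∀ p q {p′ q′} → ℚ.toℚᵘ p ℚᵘ.≃ p′ → ℚ.toℚᵘ q ℚᵘ.≃ q′ →
  ℚ.toℚᵘ (ℚ.∣ p ℚ.- q ∣) ℚᵘ.≃ ℚᵘ.∣ p′ ℚᵘ.- q′ ∣
toℚᵘ-∣-∣ p q p≃p′ q≃q′ = ℚᵘ.≃-trans (ℚ.toℚᵘ-homo-∣-∣ (p ℚ.- q))
  (ℚᵘ.∣-∣-cong (ℚᵘ.≃-trans (ℚ.toℚᵘ-homo-+ p (ℚ.- q))
    (ℚᵘ.+-cong p≃p′ (ℚᵘ.≃-trans (ℚ.toℚᵘ-homo‿- q) (ℚᵘ.-‿cong q≃q′)))))

-- The count `c` satisfies `n c = N + o(N)`; multiplying by `g` turns this into `c d = g N + o(N)`,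
-- which is then divided by `N d`.
≲⇒density : ∀ {ℓ} {T : Pred ℕ ℓ} (T? : Decidable T) g n d .{{_ : NonZero d}} → d ≡ g ℕ.* n →
  (λ N → n ℕ.* count T? N) ≲ id → id ≲ (λ N → n ℕ.* count T? N) →
  HasNaturalDensity T? (+ g / d)
≲⇒density T? g n d d≡gn c≲N N≲c (mkℚ (+ suc e) f-1 _) 0<ε =
  -- `suc f-1` is the denominator of `ε`, whose numerator is at least 1; the factor 2 makes the
  -- final bound strict.
  let k = 2 ℕ.* suc f-1
      N₁ , h₁ = c≲N k
      N₂ , h₂ = N≲c k
  in N₁ ℕ.⊔ N₂ , λ N N₁⊔N₂≤N → ℚ.toℚᵘ-cancel-< (ℚᵘ.<-respˡ-≃
    (ℚᵘ.≃-sym (toℚᵘ-∣-∣ (+ count T? N / N) (+ g / d) (toℚᵘ-/ (+ count T? N) N) (toℚᵘ-/ (+ g) d)))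
    (close N d d≡gn (h₁ N (ℕ.m⊔n≤o⇒m≤o N₁ N₂ N₁⊔N₂≤N)) (h₂ N (ℕ.m⊔n≤o⇒n≤o N₁ N₂ N₁⊔N₂≤N))))
  where
  close : ∀ N d .{{_ : NonZero N}} .{{_ : NonZero d}} → d ≡ g ℕ.* n →
    2 ℕ.* suc f-1 ℕ.* (n ℕ.* count T? N) ≤ 2 ℕ.* suc f-1 ℕ.* N ℕ.+ N →
    2 ℕ.* suc f-1 ℕ.* N ≤ 2 ℕ.* suc f-1 ℕ.* (n ℕ.* count T? N) ℕ.+ N →
    ℚᵘ.∣ + count T? N ℚᵘ./ N ℚᵘ.- + g ℚᵘ./ d ∣ ℚᵘ.< ℚᵘ.mkℚᵘ (+ suc e) f-1
  close N@(suc _) d@(suc _) d≡gn c≤ N≤ = ℚᵘ.*<*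
    (subst₂ ℤ._<_ (ℤ.pos-* A (suc f-1)) (ℤ.pos-* (suc e) (N ℕ.* d)) (ℤ.+<+ (begin-strict
      A ℕ.* suc f-1        <⟨ ℕ.*-cancelˡ-< 2 _ _ 2fA<2Nd ⟩
      N ℕ.* d              ≤⟨ ℕ.m≤n*m (N ℕ.* d) (suc e) ⟩
      suc e ℕ.* (N ℕ.* d)  ∎)))
    where
    open ℕ.≤-Reasoning
    c = count T? N
    k = 2 ℕ.* suc f-1
    -- The numerator of the absolute value of `c / N - g / d` over the denominator `N * d`.
    A = ℤ.∣ + c * + d + (- + g) * + N ∣
    scale : ∀ g k c n → g ℕ.* (k ℕ.* (n ℕ.* c)) ≡ k ℕ.* (c ℕ.* (g ℕ.* n))
    scale = ℕSolver.solve-∀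
    gknc : g ℕ.* (k ℕ.* (n ℕ.* c)) ≡ k ℕ.* (c ℕ.* d)
    gknc = trans (scale g k c n) (cong (λ z → k ℕ.* (c ℕ.* z)) (sym d≡gn))
    factor : ∀ g k a b → g ℕ.* (k ℕ.* a ℕ.+ b) ≡ g ℕ.* (k ℕ.* a) ℕ.+ g ℕ.* b
    factor = ℕSolver.solve-∀
    gkN : ∀ g k a → g ℕ.* (k ℕ.* a) ≡ k ℕ.* (g ℕ.* a)
    gkN = ℕSolver.solve-∀
    upper : k ℕ.* (c ℕ.* d) ≤ k ℕ.* (g ℕ.* N) ℕ.+ g ℕ.* N
    upper = subst₂ _≤_ gknc (trans (factor g k N N) (cong (ℕ._+ g ℕ.* N) (gkN g k N))) (ℕ.*-monoʳ-≤ g c≤)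
    lower : k ℕ.* (g ℕ.* N) ≤ k ℕ.* (c ℕ.* d) ℕ.+ g ℕ.* N
    lower = subst₂ _≤_ (gkN g k N) (trans (factor g k (n ℕ.* c) N) (cong (ℕ._+ g ℕ.* N) gknc)) (ℕ.*-monoʳ-≤ g N≤)
    pull : ∀ k c d g N → k * (c * d) - k * (g * N) ≡ k * (c * d + (- g) * N)
    pull = solve-∀
    kA : ℤ.∣ + (k ℕ.* (c ℕ.* d)) - + (k ℕ.* (g ℕ.* N)) ∣ ≡ k ℕ.* A
    kA = trans (cong ℤ.∣_∣ (trans (cong₂ _-_
        (trans (ℤ.pos-* k (c ℕ.* d)) (cong (λ z → + k * z) (ℤ.pos-* c d)))
        (trans (ℤ.pos-* k (g ℕ.* N)) (cong (λ z → + k * z) (ℤ.pos-* g N))))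
      (pull (+ k) (+ c) (+ d) (+ g) (+ N)))) (ℤ.abs-* (+ k) (+ c * + d + (- + g) * + N))
    g≤d : g ≤ d
    g≤d = ℕ.∣⇒≤ (ℕ.divides n (trans d≡gn (ℕ.*-comm g n)))
    2fA<2Nd : 2 ℕ.* (A ℕ.* suc f-1) ℕ.< 2 ℕ.* (N ℕ.* d)
    2fA<2Nd = begin-strict
      2 ℕ.* (A ℕ.* suc f-1)                                   ≡⟨ trans (cong (2 ℕ.*_) (ℕ.*-comm A (suc f-1))) (sym (ℕ.*-assoc 2 (suc f-1) A)) ⟩
      k ℕ.* A                                                 ≡⟨ kA ⟨
      ℤ.∣ + (k ℕ.* (c ℕ.* d)) - + (k ℕ.* (g ℕ.* N)) ∣          ≤⟨ ∣+-+∣≤ upper lower ⟩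
      g ℕ.* N                                                 ≤⟨ ℕ.*-monoˡ-≤ N g≤d ⟩
      d ℕ.* N                                                 ≡⟨ ℕ.*-comm d N ⟩
      N ℕ.* d                                                 <⟨ ℕ.m<m*n (N ℕ.* d) 2 (ℕ.n<1+n 1) ⟩
      N ℕ.* d ℕ.* 2                                           ≡⟨ ℕ.*-comm (N ℕ.* d) 2 ⟩
      2 ℕ.* (N ℕ.* d)                                         ∎
≲⇒density T? g n d _ _ _ (mkℚ (+ zero) f-1 _) (ℚ.*<* (ℤ.+<+ ()))
≲⇒density T? g n d _ _ _ (mkℚ (-[1+ _ ]) f-1 _) (ℚ.*<* ())

zero⇒density : ∀ {ℓ} {T : Pred ℕ ℓ} (T? : Decidable T) →
  (∀ N → count T? N ≡ 0) → HasNaturalDensity T? 0ℚ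
zero⇒density T? c≡0 ε 0<ε = 0 , λ N _ → subst (ℚ._< ε) (sym (eq N)) 0<ε
  where
  eq : ∀ N .{{_ : NonZero N}} → ℚ.∣ + count T? N / N ℚ.- 0ℚ ∣ ≡ 0ℚ
  eq N = cong (λ z → ℚ.∣ z ℚ.- 0ℚ ∣) (trans (cong (λ c → + c / N) (c≡0 N)) (ℚ.0/n≡0 N))

-- The density for `w`, by cases on the divisibility condition.

theorem3p2 : (q d : ℕ) → 2 ≤ q → (2≤d : 2 ≤ d) →
    (ψ : ℤ) → ψ ≢ 0ℤ → (θ x : ℤ) →
    HasNaturalDensity
    {T = λ n → ψ * + w q n + θ * + n + x ≡ 0ℤ [mod d ]}
    (λ n → ψ * + w q n + θ * + n + x ≡? 0ℤ [mod d ])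
    (densityValue ψ θ x d {{>-nonZero (<⇒≤ 2≤d)}})
theorem3p2 q@(suc p) d 2≤q 2≤d ψ _ θ x = density (gcd₃ ψ θ (+ d) ∣? ℤ.gcd x (+ d))
  where
  instance
    d-nonZero : NonZero d
    d-nonZero = >-nonZero (<⇒≤ 2≤d)
  open Counting d (w q) ψ
  open Valuation 2≤q using (repunit; w-block)
  open Swaps p 2≤q d using (swap-all)

  T? : Decidable (λ n → ψ * + w q n + θ * + n + x ≡ 0ℤ [mod d ])
  T? n = ψ * + w q n + θ * + n + x ≡? 0ℤ [mod d ]

  count≡hits : ∀ N → count T? N ≡ hits θ x N
  count≡hits N = trans (count≡sum T? N) (sum<-cong N λ n →
    cong hit (ℤ.+-identityʳ (value θ x n)))

  invariant-ψ : Invariance.Invariant θ ψ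
  invariant-ψ y = ≲-trans
    -- The contraction takes its block size as a successor, so the block law and the swaps are
    -- transported along `Q≡`; `δ = 1` gives the shift by `ψ` itself.
    (hits-≲-ψ (ℕ.pred Q) (repunit L)
      (subst (λ Q → ∀ m {s} → s < Q → w q (Q ℕ.* m ℕ.+ s) ≡ w q m ℕ.+ repunit L ℕ.* m ℕ.+ w q s) Q≡ (w-block L))
      (subst (λ Q → ∀ δ → ∃₂ λ s t → s < Q × t < Q × + d ∣ + t - + s × + d ∣ + w q t - (+ w q s + + δ)) Q≡ swaps)
      θ y 1)
    (≲-reflexive (hits-cong-≡ θ (cong (λ z → y + z) (ℤ.*-identityʳ ψ))))
    where
    L = proj₁ swap-all
    swaps = proj₂ swap-all
    Q = q ℕ.^ L
    Q≡ : Q ≡ suc (ℕ.pred Q)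
    Q≡ = sym (ℕ.suc-pred Q {{ℕ.m^n≢0 q L}})

  h = ℕ.gcd (ℕ.gcd ℤ.∣ ψ ∣ ℤ.∣ θ ∣) d

  h∣gcd : h ℕ.∣ ℕ.gcd ℤ.∣ ψ ∣ ℤ.∣ θ ∣
  h∣gcd = ℕ.gcd[m,n]∣m (ℕ.gcd ℤ.∣ ψ ∣ ℤ.∣ θ ∣) d
  h∣d : h ℕ.∣ d
  h∣d = ℕ.gcd[m,n]∣n (ℕ.gcd ℤ.∣ ψ ∣ ℤ.∣ θ ∣) d
  h∣ψ : + h ∣ ψ
  h∣ψ = ∣ᵤ⇒∣ (ℕ.∣-trans h∣gcd (ℕ.gcd[m,n]∣m ℤ.∣ ψ ∣ ℤ.∣ θ ∣))
  h∣θ : + h ∣ θ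
  h∣θ = ∣ᵤ⇒∣ (ℕ.∣-trans h∣gcd (ℕ.gcd[m,n]∣n ℤ.∣ ψ ∣ ℤ.∣ θ ∣))

  density : Dec (h ℕ.∣ ℕ.gcd ℤ.∣ x ∣ d) → HasNaturalDensity T? (densityValue ψ θ x d)
  density (yes h∣) = subst (HasNaturalDensity T?)
    (sym (cong (λ b → if b then + h / d else 0ℚ) (dec-true (h ℕ.∣? ℕ.gcd ℤ.∣ x ∣ d) h∣)))
    (≲⇒density T? h n d d≡hn
      (≲-trans (≲-reflexive (cong (n ℕ.*_) ∘ count≡hits)) (hits≲N h n d≡hn θ x inv h∣ψ h∣θ h∣x))
      (≲-trans (N≲hits h n d≡hn θ x inv h∣ψ h∣θ h∣x) (≲-reflexive (cong (n ℕ.*_) ∘ sym ∘ count≡hits))))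
    where
    -- With `n = d / h`, `n` times the count is `N` up to o(N), so the density is `1 / n = h / d`.
    n = ℕ.quotient h∣d
    d≡hn : d ≡ h ℕ.* n
    d≡hn = trans (ℕ._∣_.equality h∣d) (ℕ.*-comm n h)
    h∣x : + h ∣ x
    h∣x = ∣ᵤ⇒∣ (ℕ.∣-trans h∣ (ℕ.gcd[m,n]∣m ℤ.∣ x ∣ d))
    inv : Invariance.Invariant θ (+ h)
    inv = Invariance.inv-gcd₃ θ invariant-ψ
  density (no h∤) = subst (HasNaturalDensity T?)
    (sym (cong (λ b → if b then + h / d else 0ℚ) (dec-false (h ℕ.∣? ℕ.gcd ℤ.∣ x ∣ d) h∤)))
    (zero⇒density T? λ N → trans (count≡hits N)
      (hits-∤ θ x h (∣ᵤ⇒∣ h∣d) h∣ψ h∣θ (λ h∣x → h∤ (ℕ.gcd-greatest (∣⇒∣ᵤ h∣x) h∣d)) N))
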